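{- For every positive integer $n$, $$N(1,1,6;2n)=N(1,1,3;n),\qquad t(1,1,6;8n+4)=2\,t(1,1,3;n),\qquad t(1,1,6;32n+19)=4\,t(1,1,3;n).$$ Moreover, for every positive integer $n$ with $n\not\equiv 15\pmod{16}$, $$t(1,1,6;n)=\begin{cases} 4N(1,1,3;n+1)&\text{if } n\equiv 1,2\pmod 4,\\ 2N(1,1,3;n+1)&\text{if } n\equiv 0\pmod 8,\\ N(1,1,3;n+1)&\text{if } n\equiv 4\pmod 8 \text{ or } n\equiv 19\pmod{32},\\ \tfrac85N(1,1,3;n+1)&\text{if } n\equiv 7,11\pmod{16},\\ \tfrac43N(1,1,3;n+1)&\text{if } n\equiv 3\pmod{32}.\end{cases}$$
   Context: For positive integers $a,b,c$ and $n\in\mathbb{N}=\{0,1,2,\dots\}$, $N(a,b,c;n)$ denotes the number of triples $(x,y,z)\in\mathbb{Z}^3$ with $n=ax^2+by^2+cz^2$, and $t(a,b,c;n)$ denotes the number of triples $(x,y,z)\in\mathbb{Z}^3$ with $n=a\frac{x(x+1)}2+b\frac{y(y+1)}2+c\frac{z(z+1)}2$. -}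

module Defs where

open import Data.Nat as ℕ using (ℕ; zero; suc)
open import Data.Integer as ℤ using (ℤ; +_; _-_; _≟_)
open import Data.List using (List; map; upTo; concatMap; filter; length; [_])
open import Data.Product using (_×_; _,_)

intRange : ℕ → List ℤ
intRange m = map (λ i → + i - + m) (upTo (suc (m ℕ.+ m)))

triples : ℕ → List (ℤ × ℤ × ℤ)
triples m = concatMap (λ x → concatMap (λ y → map (λ z → (x , y , z)) (intRange m)) (intRange m)) (intRange m)

-- N(a,b,c;n) = #{(x,y,z) ∈ ℤ³ : n = a x² + b y² + c z²}.
-- For a,b,c ≥ 1 every solution has |x|,|y|,|z| ≤ n, so enumerating
-- the box [-(n+1), n+1]³ counts all solutions in ℤ³.
N : ℕ → ℕ → ℕ → ℕ → ℕ
N a b c n = length (filter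
  (λ { (x , y , z) → (+ a ℤ.* x ℤ.* x ℤ.+ + b ℤ.* y ℤ.* y ℤ.+ + c ℤ.* z ℤ.* z) ≟ + n })
  (triples (suc n)))

-- t(a,b,c;n) = #{(x,y,z) ∈ ℤ³ : n = a x(x+1)/2 + b y(y+1)/2 + c z(z+1)/2},
-- written equivalently (without division) as 2n = a x(x+1) + b y(y+1) + c z(z+1).
-- For a,b,c ≥ 1 every solution has -(n+1) ≤ x,y,z ≤ n, so the box
-- [-(n+1), n+1]³ contains all solutions in ℤ³.
t : ℕ → ℕ → ℕ → ℕ → ℕ
t a b c n = length (filter
  (λ { (x , y , z) → (+ a ℤ.* x ℤ.* (x ℤ.+ + 1) ℤ.+ + b ℤ.* y ℤ.* (y ℤ.+ + 1) ℤ.+ + c ℤ.* z ℤ.* (z ℤ.+ + 1)) ≟ + (2 ℕ.* n) })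
  (triples (suc n)))

{-# OPTIONS --safe #-}

-- Write m = n + 1, let r(m) = N(1,1,3;m) and let s(m) count the representations m = x² + y² + 3z²
-- with x + z odd. Completing squares and passing to half the sum and half the difference of the
-- first two variables turns t(1,1,6;n) into the number of solutions of u² + v² + 3z² = 4m with z
-- odd. Exactly one of u, v is then odd, say u, and v = 2w. The pairs (u , z) of odd numbers with
-- u² + 3z² = 4k arise exactly twice from the pairs (p , q) with p + q odd and p² + 3q² = k, by
-- multiplying p + q√−3 by a primitive cube root of unity and by 2. Hence t(1,1,6;n) = 4 s(m), and
-- likewise r(4m) = 4 s(m) + r(m) and s(4m) = 2 s(m). Congruences modulo 4 and 8 give r = s for m
-- ≡ 2, 3 (mod 4), r = 2s for m ≡ 1 (mod 8), and r = 4s for m ≡ 5 (mod 8); in the last case half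
-- of the solutions have x, y, z all odd, and these correspond to t(1,1,3;(m − 5)/8).

module Submission where

open import Defs
open import Data.Empty using (⊥; ⊥-elim)
open import Data.Integer as ℤ using (ℤ; +_; -[1+_]; ∣_∣)
open import Data.Integer.DivMod using (_/ℕ_; _%ℕ_; a≡a%ℕn+[a/ℕn]*n; n%ℕd<d)
import Data.Integer.Properties as ℤ
open import Data.Integer.Tactic.RingSolver using (solve; solve-∀)
open import Data.List using (List; []; _∷_; _++_; map; concatMap; filter; length)
open import Data.List.Membership.Propositional using (_∈_)
open import Data.List.Membership.Propositional.Properties
  using (∈-map⁺; ∈-map⁻; ∈-++⁺ˡ; ∈-++⁺ʳ; ∈-++⁻; ∈-filter⁺; ∈-filter⁻; ∈-upTo⁺; ∈-concatMap⁺; ∈-concatMap⁻)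
open import Data.List.Membership.Propositional.Properties.WithK using (unique∧set⇒bag)
open import Data.List.Properties using (length-map; length-++)
open import Data.List.Relation.Binary.BagAndSetEquality using (∼bag⇒↭)
open import Data.List.Relation.Binary.Disjoint.Propositional using (Disjoint)
open import Data.List.Relation.Binary.Permutation.Propositional.Properties using (↭-length)
import Data.List.Relation.Unary.All as All
import Data.List.Relation.Unary.All.Properties as All
import Data.List.Relation.Unary.AllPairs as AllPairs
import Data.List.Relation.Unary.AllPairs.Properties as AllPairs
import Data.List.Relation.Unary.Any as Any
open import Data.List.Relation.Unary.Unique.Propositional using (Unique)
import Data.List.Relation.Unary.Unique.Propositional.Properties as Unique
open import Data.Nat as ℕ using (ℕ; zero; suc; NonZero; z≤n; s≤s)
open import Data.Nat.Divisibility using (_∣?_; divides)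
import Data.Nat.DivMod as ℕ
import Data.Nat.Properties as ℕ
import Data.Nat.Tactic.RingSolver as ℕSolver
open import Data.Product using (∃; _×_; _,_; proj₁; proj₂)
open import Data.Sum using (_⊎_; inj₁; inj₂)
open import Function using (_∘_; id; mk⇔)
open import Relation.Binary.PropositionalEquality
  using (_≡_; _≢_; refl; sym; trans; cong; cong₂; subst; module ≡-Reasoning)
open import Relation.Nullary using (Dec; yes; no; _×-dec_)
open import Relation.Nullary.Decidable using (False; toWitnessFalse)
open import Relation.Unary using (Decidable)

-- Counting solutions through bijections.

-- A list that contains every solution exactly once has the number of solutions as its length, so
-- counts can be compared from the predicates alone, whatever the order of the lists.
record Enumeration {A : Set} (P : A → Set) : Set where
  field
    elems    : List A
    unique   : Unique elems
    sound    : ∀ {v} → v ∈ elems → P v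
    complete : ∀ {v} → P v → v ∈ elems

open Enumeration

size : {A : Set} {P : A → Set} → Enumeration P → ℕ
size e = length (elems e)

restrict : {A : Set} {P R : A → Set} → Enumeration P → Decidable R →
           Enumeration (λ v → P v × R v)
restrict e R? = record
  { elems    = filter R? (elems e)
  ; unique   = Unique.filter⁺ R? (unique e)
  ; sound    = λ v∈ → let v∈e , Rv = ∈-filter⁻ R? {xs = elems e} v∈ in sound e v∈e , Rv
  ; complete = λ (Pv , Rv) → ∈-filter⁺ R? (complete e Pv) Rv
  }

InjectiveMap : {A B : Set} → (A → B) → Set
InjectiveMap f = ∀ {v w} → f v ≡ f w → v ≡ w

Image : {A B : Set} (f : A → B) (P : A → Set) → B → Set
Image f P w = ∃ λ v → P v × f v ≡ w

-- The list for `Q` and the two mapped lists joined together are both free of duplicates and have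
-- the same members, so they are permutations of each other. Every later count rests on this
-- principle.
size-disjoint-images :
  {A A′ B : Set} {P : A → Set} {P′ : A′ → Set} {Q : B → Set}
  (p : Enumeration P) (p′ : Enumeration P′) (q : Enumeration Q)
  (f : A → B) (f′ : A′ → B) → InjectiveMap f → InjectiveMap f′ →
  (∀ v → P v → Q (f v)) → (∀ v → P′ v → Q (f′ v)) →
  (∀ w → Q w → Image f P w ⊎ Image f′ P′ w) →
  (∀ v v′ → P v → P′ v′ → f v ≡ f′ v′ → ⊥) →
  size q ≡ size p ℕ.+ size p′
size-disjoint-images p p′ q f f′ f-inj f′-inj f-maps f′-maps cover disjoint = begin
  size q
    ≡⟨ ↭-length (∼bag⇒↭ (unique∧set⇒bag (unique q) images-unique (mk⇔ to from))) ⟩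
  length (map f (elems p) ++ map f′ (elems p′))
    ≡⟨ length-++ (map f (elems p)) ⟩
  length (map f (elems p)) ℕ.+ length (map f′ (elems p′))
    ≡⟨ cong₂ ℕ._+_ (length-map f (elems p)) (length-map f′ (elems p′)) ⟩
  size p ℕ.+ size p′
    ∎
  where
  open ≡-Reasoning
  images-disjoint : Disjoint (map f (elems p)) (map f′ (elems p′))
  images-disjoint (w∈ , w∈′) with ∈-map⁻ f w∈ | ∈-map⁻ f′ w∈′
  ... | v , v∈ , refl | v′ , v′∈ , eq = disjoint v v′ (sound p v∈) (sound p′ v′∈) eq
  images-unique : Unique (map f (elems p) ++ map f′ (elems p′))
  images-unique = Unique.++⁺ (Unique.map⁺ f-inj (unique p)) (Unique.map⁺ f′-inj (unique p′)) images-disjoint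
  to : ∀ {w} → w ∈ elems q → w ∈ map f (elems p) ++ map f′ (elems p′)
  to w∈ with cover _ (sound q w∈)
  ... | inj₁ (v , Pv , refl) = ∈-++⁺ˡ (∈-map⁺ f (complete p Pv))
  ... | inj₂ (v , P′v , refl) = ∈-++⁺ʳ _ (∈-map⁺ f′ (complete p′ P′v))
  from : ∀ {w} → w ∈ map f (elems p) ++ map f′ (elems p′) → w ∈ elems q
  from w∈ with ∈-++⁻ (map f (elems p)) w∈
  ... | inj₁ w∈f with v , v∈ , refl ← ∈-map⁻ f w∈f = complete q (f-maps v (sound p v∈))
  ... | inj₂ w∈f′ with v , v∈ , refl ← ∈-map⁻ f′ w∈f′ = complete q (f′-maps v (sound p′ v∈))

∅ : Enumeration {⊥} (λ _ → ⊥)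
∅ = record { elems = [] ; unique = AllPairs.[] ; sound = λ () ; complete = λ () }

size-image :
  {A B : Set} {P : A → Set} {Q : B → Set} (p : Enumeration P) (q : Enumeration Q)
  (f : A → B) → InjectiveMap f → (∀ v → P v → Q (f v)) → (∀ w → Q w → Image f P w) →
  size q ≡ size p
size-image p q f f-inj f-maps onto = trans
  (size-disjoint-images p ∅ q f ⊥-elim f-inj (λ {}) f-maps (λ ()) (λ w Qw → inj₁ (onto w Qw)) (λ _ _ _ ()))
  (ℕ.+-identityʳ _)

size-cong :
  {A : Set} {P Q : A → Set} (p : Enumeration P) (q : Enumeration Q) →
  (∀ v → P v → Q v) → (∀ v → Q v → P v) → size q ≡ size p
size-cong p q P⇒Q Q⇒P = size-image p q id id P⇒Q (λ w Qw → w , Q⇒P w Qw , refl)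

size-empty : {A : Set} {P : A → Set} (p : Enumeration P) → (∀ v → P v → ⊥) → size p ≡ 0
size-empty p empty = size-image ∅ p ⊥-elim (λ {}) (λ ()) (λ w Pw → ⊥-elim (empty w Pw))

module TernaryForms where

  open import Data.Integer using (_+_; _*_; _-_; -_)

  -- Boxes of integer triples without repetition.

  Triple : Set
  Triple = ℤ × ℤ × ℤ

  concatMap-unique : {A B : Set} {f : A → List B} {xs : List A} → Unique xs → (∀ x → Unique (f x)) →
                     (∀ {x y} → x ≢ y → Disjoint (f x) (f y)) → Unique (concatMap f xs)
  concatMap-unique xs! f! f-disjoint =
    Unique.concat⁺ (All.map⁺ (All.universal f! _)) (AllPairs.map⁺ (AllPairs.map f-disjoint xs!))

  concatMap-∋ : {A B : Set} {f : A → List B} {x : A} {xs : List A} {y : B} → x ∈ xs → y ∈ f x → y ∈ concatMap f xs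
  concatMap-∋ {f = f} x∈ y∈ = ∈-concatMap⁺ f (Any.map (λ { refl → y∈ }) x∈)

  -- Ring solvers prove identities, not consequences of hypotheses. Supplying the multipliers `α`
  -- and `β` as a certificate turns the wanted consequence into a polynomial identity that the
  -- solver can check.
  linear-combination : ∀ {x y a b c d : ℤ} (α : ℤ) → a ≡ b → (β : ℤ) → c ≡ d →
                       x - y ≡ α * (a - b) + β * (c - d) → x ≡ y
  linear-combination {x} {y} {a} {b} {c} {d} α refl β refl eq = ℤ.i-j≡0⇒i≡j x y (trans eq (vanish α β a c))
    where
    vanish : ∀ α β a c → α * (a - a) + β * (c - c) ≡ + 0
    vanish = solve-∀

  linear-multiple : ∀ {x y a b : ℤ} (α : ℤ) → a ≡ b → x - y ≡ α * (a - b) → x ≡ y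
  linear-multiple {x} {y} {a} α refl eq = ℤ.i-j≡0⇒i≡j x y (trans eq (vanish α a))
    where
    vanish : ∀ α a → α * (a - a) ≡ + 0
    vanish = solve-∀

  -‿cancelʳ : ∀ i j m → i - m ≡ j - m → i ≡ j
  -‿cancelʳ i j m eq = linear-multiple (+ 1) eq (solve (i ∷ j ∷ m ∷ []))

  intRange-unique : ∀ m → Unique (intRange m)
  intRange-unique m = Unique.map⁺ (λ eq → ℤ.+-injective (-‿cancelʳ _ _ (+ m) eq)) (Unique.upTo⁺ _)

  triples-unique : ∀ m → Unique (triples m)
  triples-unique m = concatMap-unique (intRange-unique m) plane-unique plane-disjoint
    where
    line : ℤ → ℤ → List Triple
    line x y = map (λ z → x , y , z) (intRange m)
    plane : ℤ → List Triple
    plane x = concatMap (line x) (intRange m)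
    line-fst : ∀ {x y v} → v ∈ line x y → proj₁ v ≡ x × proj₁ (proj₂ v) ≡ y
    line-fst v∈ with _ , _ , refl ← ∈-map⁻ _ v∈ = refl , refl
    plane-fst : ∀ {x v} → v ∈ plane x → proj₁ v ≡ x
    plane-fst {x} v∈ = proj₁ (line-fst (proj₂ (Any.satisfied (∈-concatMap⁻ (line x) {xs = intRange m} v∈))))
    plane-unique : ∀ x → Unique (plane x)
    plane-unique x = concatMap-unique (intRange-unique m)
      (λ y → Unique.map⁺ (cong (proj₂ ∘ proj₂)) (intRange-unique m))
      (λ y≢y′ (v∈ , v∈′) → y≢y′ (trans (sym (proj₂ (line-fst v∈))) (proj₂ (line-fst v∈′))))
    plane-disjoint : ∀ {x x′} → x ≢ x′ → Disjoint (plane x) (plane x′)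
    plane-disjoint x≢x′ (v∈ , v∈′) = x≢x′ (trans (sym (plane-fst v∈)) (plane-fst v∈′))

  ∈-intRange : ∀ {m} x → ∣ x ∣ ℕ.≤ m → x ∈ intRange m
  ∈-intRange {m} (+ k) k≤m = subst (_∈ intRange m) (trans (cong (_- + m) (ℤ.pos-+ m k)) (shift (+ m) (+ k)))
    (∈-map⁺ (λ i → + i - + m) (∈-upTo⁺ (s≤s (ℕ.+-monoʳ-≤ m k≤m))))
    where
    shift : ∀ m k → m + k - m ≡ k
    shift = solve-∀
  ∈-intRange {m} -[1+ k ] k<m = subst (_∈ intRange m) eq
    (∈-map⁺ (λ i → + i - + m) (∈-upTo⁺ (s≤s (ℕ.≤-trans (ℕ.m∸n≤m m (suc k)) (ℕ.m≤m+n m m)))))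
    where
    shift : ∀ m k → m - k - m ≡ - k
    shift = solve-∀
    eq : + (m ℕ.∸ suc k) - + m ≡ -[1+ k ]
    eq = trans (cong (_- + m) (trans (sym (ℤ.⊖-≥ k<m)) (sym (ℤ.m-n≡m⊖n m (suc k))))) (shift (+ m) (+ suc k))

  ∈-triples : ∀ {m} x y z → ∣ x ∣ ℕ.≤ m → ∣ y ∣ ℕ.≤ m → ∣ z ∣ ℕ.≤ m → (x , y , z) ∈ triples m
  ∈-triples {m} x y z x≤ y≤ z≤ =
    concatMap-∋ {f = plane} (∈-intRange x x≤)
      (concatMap-∋ {f = line x} (∈-intRange y y≤) (∈-map⁺ (λ z → x , y , z) (∈-intRange z z≤)))
    where
    line : ℤ → ℤ → List Triple
    line x y = map (λ z → x , y , z) (intRange m)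
    plane : ℤ → List Triple
    plane x = concatMap (line x) (intRange m)

  InBox : ℕ → Triple → Set
  InBox m (x , y , z) = ∣ x ∣ ℕ.≤ m × ∣ y ∣ ℕ.≤ m × ∣ z ∣ ℕ.≤ m

  enumerateBox : ∀ m {P : Triple → Set} → Decidable P → (∀ v → P v → InBox m v) → Enumeration P
  enumerateBox m P? bounded = record
    { elems    = filter P? (triples m)
    ; unique   = Unique.filter⁺ P? (triples-unique m)
    ; sound    = λ v∈ → proj₂ (∈-filter⁻ P? {xs = triples m} v∈)
    ; complete = λ {v} Pv → let x≤ , y≤ , z≤ = bounded v Pv in ∈-filter⁺ P? (∈-triples _ _ _ x≤ y≤ z≤) Pv
    }

  -- Solutions of quadratic and triangular equations lie in the box.

  Quadratic : (a b c : ℕ) → ℤ → Triple → Set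
  Quadratic a b c m (x , y , z) = + a * x * x + + b * y * y + + c * z * z ≡ m

  Triangular : (a b c : ℕ) → ℤ → Triple → Set
  Triangular a b c m (x , y , z) =
    + a * x * (x + + 1) + + b * y * (y + + 1) + + c * z * (z + + 1) ≡ m

  square-∣∣ : ∀ x → x * x ≡ + (∣ x ∣ ℕ.* ∣ x ∣)
  square-∣∣ (+ k)    = sym (ℤ.pos-* k k)
  square-∣∣ -[1+ k ] = refl

  oblong-∣∣ : ∀ x → x * (x + + 1) ≡ + (∣ x ∣ ℕ.* ∣ x + + 1 ∣)
  oblong-∣∣ (+ k)          = sym (ℤ.pos-* k _)
  oblong-∣∣ -[1+ zero ]    = refl
  oblong-∣∣ -[1+ suc k ]   = refl

  scale-pos : ∀ a {x y k} → x * y ≡ + k → + a * x * y ≡ + (a ℕ.* k)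
  scale-pos a {x} {y} {k} eq =
    trans (ℤ.*-assoc (+ a) x y) (trans (cong (+ a *_) eq) (sym (ℤ.pos-* a k)))

  -- The summands are casts of naturals, hence nonnegative, so none of them exceeds the total.
  summands-≤ : ∀ {p q r m} → + p + + q + + r ≡ m → p ℕ.≤ ∣ m ∣ × q ℕ.≤ ∣ m ∣ × r ℕ.≤ ∣ m ∣
  summands-≤ {p} {q} {r} refl =
    ℕ.≤-trans (ℕ.m≤m+n p q) (ℕ.m≤m+n _ r) , ℕ.≤-trans (ℕ.m≤n+m q p) (ℕ.m≤m+n _ r) , ℕ.m≤n+m r (p ℕ.+ q)

  square-bound : ∀ k {m} → k ℕ.* k ℕ.≤ m → k ℕ.≤ suc m
  square-bound zero    _   = z≤n
  square-bound (suc k) k²≤ = ℕ.m≤n⇒m≤1+n (ℕ.≤-trans (ℕ.m≤m*n (suc k) (suc k)) k²≤)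

  double-bound : ∀ k {n} → suc k ℕ.* suc (suc k) ℕ.≤ 2 ℕ.* n → suc k ℕ.≤ n
  double-bound k {n} ≤2n = ℕ.*-cancelˡ-≤ 2
    (ℕ.≤-trans (ℕ.≤-reflexive (ℕ.*-comm 2 (suc k))) (ℕ.≤-trans (ℕ.*-monoʳ-≤ (suc k) (s≤s (s≤s z≤n))) ≤2n))

  oblong-bound : ∀ x {n} → ∣ x ∣ ℕ.* ∣ x + + 1 ∣ ℕ.≤ 2 ℕ.* n → ∣ x ∣ ℕ.≤ suc n
  oblong-bound (+ zero)       _   = z≤n
  oblong-bound (+ suc k)      ≤2n rewrite ℕ.+-comm k 1 = ℕ.m≤n⇒m≤1+n (double-bound k ≤2n)
  oblong-bound -[1+ zero ]    _   = s≤s z≤n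
  -- Here x = -(k + 2) and x + 1 has absolute value k + 1, so only k + 1 ≤ n follows. The value x =
  -- -(n + 1) can occur, as for n = 1, which is why the radius is n + 1.
  oblong-bound -[1+ suc k ] {n} ≤2n = s≤s (double-bound k (subst (ℕ._≤ 2 ℕ.* n) (ℕ.*-comm (suc (suc k)) (suc k)) ≤2n))

  module _ (a b c : ℕ) .{{_ : NonZero a}} .{{_ : NonZero b}} .{{_ : NonZero c}} where

    quadratic-bounded : ∀ m v → Quadratic a b c m v → InBox (suc ∣ m ∣) v
    quadratic-bounded m (x , y , z) eq =
      let p , q , r = summands-≤ (trans (sym (cong₂ _+_ (cong₂ _+_ (term a x) (term b y)) (term c z))) eq)
      in bound a x p , bound b y q , bound c z r
      where
      term : ∀ a x → + a * x * x ≡ + (a ℕ.* (∣ x ∣ ℕ.* ∣ x ∣))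
      term a x = scale-pos a (square-∣∣ x)
      bound : ∀ a .{{_ : NonZero a}} x → a ℕ.* (∣ x ∣ ℕ.* ∣ x ∣) ℕ.≤ ∣ m ∣ → ∣ x ∣ ℕ.≤ suc ∣ m ∣
      bound a x ≤m = square-bound ∣ x ∣ (ℕ.≤-trans (ℕ.m≤n*m _ a) ≤m)

    triangular-bounded : ∀ n v → Triangular a b c (+ (2 ℕ.* n)) v → InBox (suc n) v
    triangular-bounded n (x , y , z) eq =
      let p , q , r = summands-≤ (trans (sym (cong₂ _+_ (cong₂ _+_ (term a x) (term b y)) (term c z))) eq)
      in bound a x p , bound b y q , bound c z r
      where
      term : ∀ a x → + a * x * (x + + 1) ≡ + (a ℕ.* (∣ x ∣ ℕ.* ∣ x + + 1 ∣))
      term a x = scale-pos a (oblong-∣∣ x)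
      bound : ∀ a .{{_ : NonZero a}} x → a ℕ.* (∣ x ∣ ℕ.* ∣ x + + 1 ∣) ℕ.≤ 2 ℕ.* n → ∣ x ∣ ℕ.≤ suc n
      bound a x ≤m = oblong-bound x (ℕ.≤-trans (ℕ.m≤n*m _ a) ≤m)

    -- Box and decision procedure are those of Defs, so that N a b c n and t a b c n reduce to the
    -- sizes of these enumerations.
    quadratics : ∀ m → Enumeration (Quadratic a b c m)
    quadratics m = enumerateBox (suc ∣ m ∣) (λ _ → _ ℤ.≟ m) (quadratic-bounded m)

    triangulars : ∀ n → Enumeration (Triangular a b c (+ (2 ℕ.* n)))
    triangulars n = enumerateBox (suc n) (λ _ → _ ℤ.≟ + (2 ℕ.* n)) (triangular-bounded n)

  -- Parity and divisibility.

  -- For numerals `d` and `c` the non-divisibility is decided by computation and filled in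
  -- implicitly, so a contradiction modulo `d` needs only the quotient `j` and a linear certificate.
  multiple-absurd : ∀ d c {_ : False (d ∣? c)} j → + d * j ≡ + c → ⊥
  multiple-absurd d c {d∤c} j eq = toWitnessFalse d∤c
    (divides ∣ j ∣ (trans (sym (cong ∣_∣ eq)) (trans (ℤ.abs-* (+ d) j) (ℕ.*-comm d ∣ j ∣))))

  Even Odd : ℤ → Set
  Even x = ∃ λ k → x ≡ + 2 * k
  Odd  x = ∃ λ k → x ≡ + 2 * k + + 1

  parity : ∀ x → Even x ⊎ Odd x
  parity x with x %ℕ 2 | n%ℕd<d x 2 | a≡a%ℕn+[a/ℕn]*n x 2
  ... | 0           | _              | eq = inj₁ (x /ℕ 2 , trans eq (halve (x /ℕ 2)))
    where
    halve : ∀ k → + 0 + k * + 2 ≡ + 2 * k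
    halve = solve-∀
  ... | 1           | _              | eq = inj₂ (x /ℕ 2 , trans eq (halve (x /ℕ 2)))
    where
    halve : ∀ k → + 1 + k * + 2 ≡ + 2 * k + + 1
    halve = solve-∀
  ... | suc (suc _) | s≤s (s≤s ()) | _

  even-odd-absurd : ∀ {x} → Even x → Odd x → ⊥
  even-odd-absurd {x} (k , refl) (l , eq) =
    multiple-absurd 2 1 (k - l) (linear-multiple (+ 1) eq (solve (k ∷ l ∷ [])))

  odd? : ∀ x → Dec (Odd x)
  odd? x with parity x
  ... | inj₁ x-even = no (even-odd-absurd x-even)
  ... | inj₂ x-odd  = yes x-odd

  even? : ∀ x → Dec (Even x)
  even? x with parity x
  ... | inj₁ x-even = yes x-even
  ... | inj₂ x-odd  = no λ x-even → even-odd-absurd x-even x-odd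

  odd+even : ∀ {x y} → Odd x → Even y → Odd (x + y)
  odd+even (k , refl) (l , refl) = k + l , solve (k ∷ l ∷ [])

  even+odd : ∀ {x y} → Even x → Odd y → Odd (x + y)
  even+odd (k , refl) (l , refl) = k + l , solve (k ∷ l ∷ [])

  even+even : ∀ {x y} → Even x → Even y → Even (x + y)
  even+even (k , refl) (l , refl) = k + l , solve (k ∷ l ∷ [])

  odd+odd : ∀ {x y} → Odd x → Odd y → Even (x + y)
  odd+odd (k , refl) (l , refl) = k + l + + 1 , solve (k ∷ l ∷ [])

  -- (2k + 1)² = 4k(k + 1) + 1, and k(k + 1) is even; the witness is k(k + 1)/2.
  odd-square : ∀ {x} → Odd x → ∃ λ b → x * x ≡ + 8 * b + + 1
  odd-square (k , refl) = cases (parity k)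
    where
    cases : ∀ {k} → Even k ⊎ Odd k → ∃ λ b → (+ 2 * k + + 1) * (+ 2 * k + + 1) ≡ + 8 * b + + 1
    cases (inj₁ (l , refl)) = l * (+ 2 * l + + 1) , solve (l ∷ [])
    cases (inj₂ (l , refl)) = (+ 2 * l + + 1) * (l + + 1) , solve (l ∷ [])

  -- The form x² + y² + 3z² modulo 4.

  F : ℤ → Triple → Set
  F = Quadratic 1 1 3

  OddEvenOdd EvenOddOdd AllEven OddEvenEven EvenOddEven AllOdd OddSum OddLast EvenLast : Triple → Set
  OddEvenOdd  (x , y , z) = Odd x × Even y × Odd z
  EvenOddOdd  (x , y , z) = Even x × Odd y × Odd z
  AllEven     (x , y , z) = Even x × Even y × Even z
  OddEvenEven (x , y , z) = Odd x × Even y × Even z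
  EvenOddEven (x , y , z) = Even x × Odd y × Even z
  AllOdd      (x , y , z) = Odd x × Odd y × Odd z
  OddSum      (x , y , z) = Odd (x + z)
  OddLast     (x , y , z) = Odd z
  EvenLast    (x , y , z) = Even z

  -- Squares are 0 or 1 modulo 4 and 3 ≡ -1, so the number of odd entries among x, y minus that
  -- among z must vanish modulo 4. It lies between -1 and 2, so it is 0.
  residue₀ : ∀ m v → F (+ 4 * m) v → OddEvenOdd v ⊎ EvenOddOdd v ⊎ AllEven v
  residue₀ m _ eq = cases {m} eq (parity _) (parity _) (parity _)
    where
    cases : ∀ {m x y z} → F (+ 4 * m) (x , y , z) → Even x ⊎ Odd x → Even y ⊎ Odd y → Even z ⊎ Odd z →
      OddEvenOdd (x , y , z) ⊎ EvenOddOdd (x , y , z) ⊎ AllEven (x , y , z)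
    cases _ (inj₂ p) (inj₁ q) (inj₂ r) = inj₁ (p , q , r)
    cases _ (inj₁ p) (inj₂ q) (inj₂ r) = inj₂ (inj₁ (p , q , r))
    cases _ (inj₁ p) (inj₁ q) (inj₁ r) = inj₂ (inj₂ (p , q , r))
    -- In each excluded case the constants of the odd squares sum to a number that 4 does not
    -- divide; the witness is m minus a quarter of the remaining terms.
    cases {m} eq (inj₁ (a , refl)) (inj₁ (b , refl)) (inj₂ (c , refl)) =
      ⊥-elim (multiple-absurd 4 3 (m - a * a - b * b - + 3 * c * c - + 3 * c)
      (linear-multiple (- + 1) eq (solve (a ∷ b ∷ c ∷ m ∷ []))))
    cases {m} eq (inj₁ (a , refl)) (inj₂ (b , refl)) (inj₁ (c , refl)) =
      ⊥-elim (multiple-absurd 4 1 (m - a * a - b * b - b - + 3 * c * c)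
      (linear-multiple (- + 1) eq (solve (a ∷ b ∷ c ∷ m ∷ []))))
    cases {m} eq (inj₂ (a , refl)) (inj₁ (b , refl)) (inj₁ (c , refl)) =
      ⊥-elim (multiple-absurd 4 1 (m - a * a - a - b * b - + 3 * c * c)
      (linear-multiple (- + 1) eq (solve (a ∷ b ∷ c ∷ m ∷ []))))
    cases {m} eq (inj₂ (a , refl)) (inj₂ (b , refl)) (inj₁ (c , refl)) =
      ⊥-elim (multiple-absurd 4 2 (m - a * a - a - b * b - b - + 3 * c * c)
      (linear-multiple (- + 1) eq (solve (a ∷ b ∷ c ∷ m ∷ []))))
    cases {m} eq (inj₂ (a , refl)) (inj₂ (b , refl)) (inj₂ (c , refl)) =
      ⊥-elim (multiple-absurd 4 5 (m - a * a - a - b * b - b - + 3 * c * c - + 3 * c)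
      (linear-multiple (- + 1) eq (solve (a ∷ b ∷ c ∷ m ∷ []))))

  -- By the same count, the number of odd entries among x, y minus that among z must now be 1.
  residue₁ : ∀ m v → F (+ 4 * m + + 1) v → OddEvenEven v ⊎ EvenOddEven v ⊎ AllOdd v
  residue₁ m _ eq = cases {m} eq (parity _) (parity _) (parity _)
    where
    cases : ∀ {m x y z} → F (+ 4 * m + + 1) (x , y , z) → Even x ⊎ Odd x → Even y ⊎ Odd y → Even z ⊎ Odd z →
      OddEvenEven (x , y , z) ⊎ EvenOddEven (x , y , z) ⊎ AllOdd (x , y , z)
    cases _ (inj₂ p) (inj₁ q) (inj₁ r) = inj₁ (p , q , r)
    cases _ (inj₁ p) (inj₂ q) (inj₁ r) = inj₂ (inj₁ (p , q , r))
    cases _ (inj₂ p) (inj₂ q) (inj₂ r) = inj₂ (inj₂ (p , q , r))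
    cases {m} eq (inj₁ (a , refl)) (inj₁ (b , refl)) (inj₁ (c , refl)) =
      ⊥-elim (multiple-absurd 4 1 (a * a + b * b + + 3 * c * c - m)
      (linear-multiple (+ 1) eq (solve (a ∷ b ∷ c ∷ m ∷ []))))
    cases {m} eq (inj₁ (a , refl)) (inj₁ (b , refl)) (inj₂ (c , refl)) =
      ⊥-elim (multiple-absurd 4 2 (m - a * a - b * b - + 3 * c * c - + 3 * c)
      (linear-multiple (- + 1) eq (solve (a ∷ b ∷ c ∷ m ∷ []))))
    cases {m} eq (inj₁ (a , refl)) (inj₂ (b , refl)) (inj₂ (c , refl)) =
      ⊥-elim (multiple-absurd 4 3 (m - a * a - b * b - b - + 3 * c * c - + 3 * c)
      (linear-multiple (- + 1) eq (solve (a ∷ b ∷ c ∷ m ∷ []))))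
    cases {m} eq (inj₂ (a , refl)) (inj₁ (b , refl)) (inj₂ (c , refl)) =
      ⊥-elim (multiple-absurd 4 3 (m - a * a - a - b * b - + 3 * c * c - + 3 * c)
      (linear-multiple (- + 1) eq (solve (a ∷ b ∷ c ∷ m ∷ []))))
    cases {m} eq (inj₂ (a , refl)) (inj₂ (b , refl)) (inj₁ (c , refl)) =
      ⊥-elim (multiple-absurd 4 1 (m - a * a - a - b * b - b - + 3 * c * c)
      (linear-multiple (- + 1) eq (solve (a ∷ b ∷ c ∷ m ∷ []))))

  -- Substituting x = 2k - z gives x² + 3z² = 4(k² - kz + z²), so m ≡ y² modulo 4. For m ≡ 2, 3 the
  -- sum x + z is therefore always odd.
  residue-even-sum : ∀ {m x y z} → F m (x , y , z) → Even (x + z) → ∃ λ q → m ≡ + 4 * q ⊎ m ≡ + 4 * q + + 1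
  residue-even-sum {m} {x} {y} {z} eq (k , x+z≡2k) = cases (parity y) eq
    where
    cases : ∀ {y} → Even y ⊎ Odd y → F m (x , y , z) → ∃ λ q → m ≡ + 4 * q ⊎ m ≡ + 4 * q + + 1
    cases (inj₁ (b , refl)) eq = k * k - k * z + z * z + b * b , inj₁
      -- The multiplier x + 2k - z is the cofactor of x + z - 2k in x² - (2k - z)².
      (linear-combination (- + 1) eq (x + + 2 * k - z) x+z≡2k (solve (x ∷ z ∷ k ∷ b ∷ m ∷ [])))
    cases (inj₂ (b , refl)) eq = k * k - k * z + z * z + b * b + b , inj₂
      (linear-combination (- + 1) eq (x + + 2 * k - z) x+z≡2k (solve (x ∷ z ∷ k ∷ b ∷ m ∷ [])))

  forms : ∀ m → Enumeration (F m)
  forms = quadratics 1 1 3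

  oddLast : ∀ m → Enumeration (λ v → F m v × OddLast v)
  oddLast m = restrict (forms m) (λ (_ , _ , z) → odd? z)

  evenLast : ∀ m → Enumeration (λ v → F m v × EvenLast v)
  evenLast m = restrict (forms m) (λ (_ , _ , z) → even? z)

  oddEvenOdd : ∀ m → Enumeration (λ v → F m v × OddEvenOdd v)
  oddEvenOdd m = restrict (forms m) (λ (x , y , z) → odd? x ×-dec even? y ×-dec odd? z)

  allOdd : ∀ m → Enumeration (λ v → F m v × AllOdd v)
  allOdd m = restrict (forms m) (λ (x , y , z) → odd? x ×-dec odd? y ×-dec odd? z)

  oddSum : ∀ m → Enumeration (λ v → F m v × OddSum v)
  oddSum m = restrict (forms m) (λ (x , y , z) → odd? (x + z))

  -- Representations of 4m: exchange, doubling and rotation.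

  swap : Triple → Triple
  swap (x , y , z) = y , x , z

  swap-injective : InjectiveMap swap
  swap-injective refl = refl

  swap-F : ∀ {m} v → F m v → F m (swap v)
  swap-F (x , y , z) eq = trans (cong (_+ + 3 * z * z) (ℤ.+-comm (+ 1 * y * y) (+ 1 * x * x))) eq

  triple-≡ : ∀ {x y z x′ y′ z′ : ℤ} → x ≡ x′ → y ≡ y′ → z ≡ z′ → (x , y , z) ≡ (x′ , y′ , z′)
  triple-≡ refl refl refl = refl

  -- When z is odd, exactly one of x and y is odd, and `swap` exchanges the two possibilities.
  size-oddLast-4* : ∀ m →
    size (oddLast (+ 4 * m)) ≡ size (oddEvenOdd (+ 4 * m)) ℕ.+ size (oddEvenOdd (+ 4 * m))
  size-oddLast-4* m = size-disjoint-images (oddEvenOdd _) (oddEvenOdd _) (oddLast _) id swap id swap-injective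
    (λ v (eq , _ , _ , z-odd) → eq , z-odd)
    (λ v (eq , _ , _ , z-odd) → swap-F v eq , z-odd)
    cover
    (λ { v v′ (_ , x-odd , _) (_ , _ , x-even , _) refl → even-odd-absurd x-even x-odd })
    where
    cover : ∀ w → F (+ 4 * m) w × OddLast w →
            Image id (λ v → F (+ 4 * m) v × OddEvenOdd v) w ⊎ Image swap (λ v → F (+ 4 * m) v × OddEvenOdd v) w
    cover w (eq , z-odd) with residue₀ m w eq
    ... | inj₁ parities                       = inj₁ (w , (eq , parities) , refl)
    ... | inj₂ (inj₁ (x-even , y-odd , _))    = inj₂ (swap w , (swap-F w eq , y-odd , x-even , z-odd) , refl)
    ... | inj₂ (inj₂ (_ , _ , z-even))        = ⊥-elim (even-odd-absurd z-even z-odd)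

  size-oddSum-4* : ∀ m → size (oddSum (+ 4 * m)) ≡ size (oddEvenOdd (+ 4 * m))
  size-oddSum-4* m = size-image (oddEvenOdd _) (oddSum _) swap swap-injective
    (λ v (eq , _ , y-even , z-odd) → swap-F v eq , even+odd y-even z-odd) onto
    where
    onto : ∀ w → F (+ 4 * m) w × OddSum w → Image swap (λ v → F (+ 4 * m) v × OddEvenOdd v) w
    onto w (eq , x+z-odd) with residue₀ m w eq
    ... | inj₁ (x-odd , _ , z-odd)              = ⊥-elim (even-odd-absurd (odd+odd x-odd z-odd) x+z-odd)
    ... | inj₂ (inj₁ (x-even , y-odd , z-odd))  = swap w , (swap-F w eq , y-odd , x-even , z-odd) , refl
    ... | inj₂ (inj₂ (x-even , _ , z-even))     = ⊥-elim (even-odd-absurd (even+even x-even z-even) x+z-odd)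

  double : Triple → Triple
  double (x , y , z) = + 2 * x , + 2 * y , + 2 * z

  double-injective : InjectiveMap double
  double-injective eq = triple-≡
    (ℤ.*-cancelˡ-≡ (+ 2) _ _ (cong proj₁ eq))
    (ℤ.*-cancelˡ-≡ (+ 2) _ _ (cong (proj₁ ∘ proj₂) eq))
    (ℤ.*-cancelˡ-≡ (+ 2) _ _ (cong (proj₂ ∘ proj₂) eq))

  -- If z is even then so are x and y, and halving all three leaves a representation of m.
  size-forms-4* : ∀ m → size (forms (+ 4 * m)) ≡ size (oddLast (+ 4 * m)) ℕ.+ size (forms m)
  size-forms-4* m = size-disjoint-images (oddLast _) (forms _) (forms _) id double id double-injective
    (λ _ → proj₁)
    (λ (x , y , z) → scale x y z)
    cover
    (λ { v (x , y , z) (_ , z-odd) _ refl → even-odd-absurd (z , refl) z-odd })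
    where
    scale : ∀ x y z → F m (x , y , z) → F (+ 4 * m) (+ 2 * x , + 2 * y , + 2 * z)
    scale x y z eq = linear-multiple (+ 4) eq (solve (x ∷ y ∷ z ∷ m ∷ []))
    halve : ∀ x y z → F (+ 4 * m) (+ 2 * x , + 2 * y , + 2 * z) → F m (x , y , z)
    halve x y z eq = ℤ.*-cancelˡ-≡ (+ 4) _ _ (linear-multiple (+ 1) eq (solve (x ∷ y ∷ z ∷ m ∷ [])))
    cover : ∀ w → F (+ 4 * m) w →
            Image id (λ v → F (+ 4 * m) v × OddLast v) w ⊎ Image double (F m) w
    cover w eq with residue₀ m w eq
    ... | inj₁ (_ , _ , z-odd)          = inj₁ (w , (eq , z-odd) , refl)
    ... | inj₂ (inj₁ (_ , _ , z-odd))   = inj₁ (w , (eq , z-odd) , refl)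
    ... | inj₂ (inj₂ ((x , refl) , (y , refl) , (z , refl))) = inj₂ ((x , y , z) , halve x y z eq , refl)

  -- Up to signs, these multiply p + q√−3 by 2ω for the two primitive cube roots of unity ω,
  -- so the form p² + 3q² is multiplied by 4.
  rotate rotate′ : (ℤ → ℤ) → Triple → Triple
  rotate  g (p , w , q) = p + + 3 * q , g w , p - q
  rotate′ g (p , w , q) = p + + 3 * q , g w , q - p

  -- The two combinations differ by 4q, which determines q and then p.
  rotation-injective : ∀ {p q p′ q′} → p + + 3 * q ≡ p′ + + 3 * q′ → p - q ≡ p′ - q′ → p ≡ p′ × q ≡ q′
  rotation-injective {p} {q} {p′} {q′} e₁ e₂ =
    linear-combination (+ 1) e₂ (+ 1) q≡q′ (solve (p ∷ q ∷ p′ ∷ q′ ∷ [])) , q≡q′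
    where
    q≡q′ : q ≡ q′
    q≡q′ = ℤ.*-cancelˡ-≡ (+ 4) q q′ (linear-combination (+ 1) e₁ (- + 1) e₂ (solve (p ∷ q ∷ p′ ∷ q′ ∷ [])))

  rotate-injective : ∀ {g} → InjectiveMap g → InjectiveMap (rotate g)
  rotate-injective g-injective {p , _ , q} {p′ , _ , q′} eq =
    let p≡ , q≡ = rotation-injective (cong proj₁ eq) (cong (proj₂ ∘ proj₂) eq)
    in triple-≡ p≡ (g-injective (cong (proj₁ ∘ proj₂) eq)) q≡

  rotate′-injective : ∀ {g} → InjectiveMap g → InjectiveMap (rotate′ g)
  rotate′-injective g-injective {p , _ , q} {p′ , _ , q′} eq =
    let p≡ , q≡ = rotation-injective (cong proj₁ eq) (negate (cong (proj₂ ∘ proj₂) eq))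
    in triple-≡ p≡ (g-injective (cong (proj₁ ∘ proj₂) eq)) q≡
    where
    negate : q - p ≡ q′ - p′ → p - q ≡ p′ - q′
    negate eq = linear-multiple (- + 1) eq (solve (p ∷ q ∷ p′ ∷ q′ ∷ []))

  -- For odd u and z exactly one of u ≡ z and u ≡ −z holds modulo 4; it selects the rotation.
  rotations-cover : ∀ {u z} → Odd u → Odd z →
    ∃ λ p → ∃ λ q → p + + 3 * q ≡ u × (p - q ≡ z ⊎ q - p ≡ z)
  rotations-cover (a , refl) (c , refl) = cases (parity (a - c))
    where
    cases : Even (a - c) ⊎ Odd (a - c) →
      ∃ λ p → ∃ λ q → p + + 3 * q ≡ + 2 * a + + 1 × (p - q ≡ + 2 * c + + 1 ⊎ q - p ≡ + 2 * c + + 1)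
    -- The equations p + 3q = u and p - q = z give 4q = u - z = 4l, hence q = l and p = z + l. In
    -- the other case q - p = z gives 4q = u + z, hence q = c + l + 1.
    cases (inj₁ (l , eq)) = + 2 * c + + 1 + l , l
      , linear-multiple (- + 2) eq (solve (a ∷ c ∷ l ∷ [])) , inj₁ (solve (c ∷ l ∷ []))
    cases (inj₂ (l , eq)) = l - c , c + l + + 1
      , linear-multiple (- + 2) eq (solve (a ∷ c ∷ l ∷ [])) , inj₂ (solve (c ∷ l ∷ []))

  -- A common image with outer coordinates u and z would satisfy u - z = 4q and u + z = 4q′, so 2u
  -- would be a multiple of 4 although u is odd.
  rotations-disjoint : ∀ {g} v v′ → Odd (proj₁ (rotate g v)) → rotate g v ≡ rotate′ g v′ → ⊥
  rotations-disjoint (p , _ , q) (p′ , _ , q′) (k , e) eq = multiple-absurd 4 2 (q + q′ - k)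
    (combine e (trans (sym (cong proj₁ eq)) e) (cong (proj₂ ∘ proj₂) eq))
    where
    combine : p + + 3 * q ≡ + 2 * k + + 1 → p′ + + 3 * q′ ≡ + 2 * k + + 1 → p - q ≡ q′ - p′ → + 4 * (q + q′ - k) ≡ + 2
    combine e e′ e″ = linear-combination (+ 1) (cong₂ _+_ e e′) (- + 1) e″ (solve (p ∷ q ∷ p′ ∷ q′ ∷ k ∷ []))

  odd-p+3q : ∀ p q → Odd (p + q) → Odd (p + + 3 * q)
  odd-p+3q p q (k , eq) = k + q , linear-multiple (+ 1) eq (solve (p ∷ q ∷ k ∷ []))

  odd-p-q : ∀ p q → Odd (p + q) → Odd (p - q)
  odd-p-q p q (k , eq) = k - q , linear-multiple (+ 1) eq (solve (p ∷ q ∷ k ∷ []))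

  odd-q-p : ∀ p q → Odd (p + q) → Odd (q - p)
  odd-q-p p q (k , eq) = k - p , linear-multiple (+ 1) eq (solve (p ∷ q ∷ k ∷ []))

  odd-p+q : ∀ p q → Odd (p + + 3 * q) → Odd (p + q)
  odd-p+q p q (k , eq) = k - q , linear-multiple (+ 1) eq (solve (p ∷ q ∷ k ∷ []))

  -- (p + 3q)² + 3(p - q)² = 4(p² + 3q²), while the middle coordinate is doubled. Every target
  -- triple comes from exactly one of the two rotations, so each contributes one copy of the
  -- `OddSum` class.
  size-oddEvenOdd-4* : ∀ m → size (oddEvenOdd (+ 4 * m)) ≡ size (oddSum m) ℕ.+ size (oddSum m)
  size-oddEvenOdd-4* m = size-disjoint-images (oddSum m) (oddSum m) (oddEvenOdd _)
    (rotate (+ 2 *_)) (rotate′ (+ 2 *_)) (rotate-injective 2*-injective) (rotate′-injective 2*-injective)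
    (λ (p , w , q) (eq , p+q-odd) →
      turn p w q eq , odd-p+3q p q p+q-odd , (w , refl) , odd-p-q p q p+q-odd)
    (λ (p , w , q) (eq , p+q-odd) →
      turn′ p w q eq , odd-p+3q p q p+q-odd , (w , refl) , odd-q-p p q p+q-odd)
    cover
    (λ v@(p , _ , q) v′ (_ , p+q-odd) _ → rotations-disjoint v v′ (odd-p+3q p q p+q-odd))
    where
    2*-injective : InjectiveMap (+ 2 *_)
    2*-injective = ℤ.*-cancelˡ-≡ (+ 2) _ _
    turn : ∀ p w q → F m (p , w , q) → F (+ 4 * m) (p + + 3 * q , + 2 * w , p - q)
    turn p w q eq = linear-multiple (+ 4) eq (solve (p ∷ w ∷ q ∷ m ∷ []))
    turn′ : ∀ p w q → F m (p , w , q) → F (+ 4 * m) (p + + 3 * q , + 2 * w , q - p)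
    turn′ p w q eq = linear-multiple (+ 4) eq (solve (p ∷ w ∷ q ∷ m ∷ []))
    unturn : ∀ p w q → F (+ 4 * m) (p + + 3 * q , + 2 * w , p - q) → F m (p , w , q)
    unturn p w q eq = ℤ.*-cancelˡ-≡ (+ 4) _ _ (linear-multiple (+ 1) eq (solve (p ∷ w ∷ q ∷ m ∷ [])))
    unturn′ : ∀ p w q → F (+ 4 * m) (p + + 3 * q , + 2 * w , q - p) → F m (p , w , q)
    unturn′ p w q eq = ℤ.*-cancelˡ-≡ (+ 4) _ _ (linear-multiple (+ 1) eq (solve (p ∷ w ∷ q ∷ m ∷ [])))
    cover : ∀ w → F (+ 4 * m) w × OddEvenOdd w →
            Image (rotate (+ 2 *_)) (λ v → F m v × OddSum v) w ⊎ Image (rotate′ (+ 2 *_)) (λ v → F m v × OddSum v) w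
    cover _ (eq , u-odd , (w , refl) , z-odd) with rotations-cover u-odd z-odd
    ... | p , q , refl , inj₁ refl = inj₁ ((p , w , q) , (unturn p w q eq , odd-p+q p q u-odd) , refl)
    ... | p , q , refl , inj₂ refl = inj₂ ((p , w , q) , (unturn′ p w q eq , odd-p+q p q u-odd) , refl)

  -- Comparing all representations with those having x + z odd.

  size-forms-oddSum : ∀ m → (∀ q → m ≢ + 4 * q) → (∀ q → m ≢ + 4 * q + + 1) → size (forms m) ≡ size (oddSum m)
  size-forms-oddSum m m≢4q m≢4q+1 = size-cong (oddSum m) (forms m) (λ _ → proj₁) sum-odd
    where
    sum-odd : ∀ v → F m v → F m v × OddSum v
    sum-odd (x , y , z) eq with parity (x + z)
    ... | inj₂ x+z-odd = eq , x+z-odd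
    ... | inj₁ x+z-even with residue-even-sum {m} {x} {y} {z} eq x+z-even
    ...   | q , inj₁ m≡4q   = ⊥-elim (m≢4q q m≡4q)
    ...   | q , inj₂ m≡4q+1 = ⊥-elim (m≢4q+1 q m≡4q+1)

  size-forms-4*+2 : ∀ k → size (forms (+ 4 * k + + 2)) ≡ size (oddSum (+ 4 * k + + 2))
  size-forms-4*+2 k = size-forms-oddSum (+ 4 * k + + 2)
    (λ q eq → multiple-absurd 4 2 (q - k) (linear-multiple (- + 1) eq (solve (q ∷ k ∷ []))))
    (λ q eq → multiple-absurd 4 1 (q - k) (linear-multiple (- + 1) eq (solve (q ∷ k ∷ []))))

  size-forms-4*+3 : ∀ k → size (forms (+ 4 * k + + 3)) ≡ size (oddSum (+ 4 * k + + 3))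
  size-forms-4*+3 k = size-forms-oddSum (+ 4 * k + + 3)
    (λ q eq → multiple-absurd 4 3 (q - k) (linear-multiple (- + 1) eq (solve (q ∷ k ∷ []))))
    (λ q eq → multiple-absurd 4 2 (q - k) (linear-multiple (- + 1) eq (solve (q ∷ k ∷ []))))

  size-forms-4*+1 : ∀ k →
    size (forms (+ 4 * k + + 1)) ≡ size (evenLast (+ 4 * k + + 1)) ℕ.+ size (allOdd (+ 4 * k + + 1))
  size-forms-4*+1 k = size-disjoint-images (evenLast _) (allOdd _) (forms _) id id id id (λ _ → proj₁) (λ _ → proj₁) cover
    (λ { v _ (_ , z-even) (_ , _ , _ , z-odd) refl → even-odd-absurd z-even z-odd })
    where
    cover : ∀ w → F (+ 4 * k + + 1) w →
            Image id (λ v → F (+ 4 * k + + 1) v × EvenLast v) w ⊎ Image id (λ v → F (+ 4 * k + + 1) v × AllOdd v) w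
    cover w eq with residue₁ k w eq
    ... | inj₁ (_ , _ , z-even)         = inj₁ (w , (eq , z-even) , refl)
    ... | inj₂ (inj₁ (_ , _ , z-even))  = inj₁ (w , (eq , z-even) , refl)
    ... | inj₂ (inj₂ odds)              = inj₂ (w , (eq , odds) , refl)

  oddSum⇒oddEvenEven : ∀ k v → F (+ 4 * k + + 1) v → OddSum v → OddEvenEven v
  oddSum⇒oddEvenEven k v eq x+z-odd with residue₁ k v eq
  ... | inj₁ parities                      = parities
  ... | inj₂ (inj₁ (x-even , _ , z-even))  = ⊥-elim (even-odd-absurd (even+even x-even z-even) x+z-odd)
  ... | inj₂ (inj₂ (x-odd , _ , z-odd))    = ⊥-elim (even-odd-absurd (odd+odd x-odd z-odd) x+z-odd)

  -- With z even, exactly one of x and y is odd. If it is x, then x + z is odd; otherwise this holds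
  -- after `swap`.
  size-evenLast-4*+1 : ∀ k →
    size (evenLast (+ 4 * k + + 1)) ≡ size (oddSum (+ 4 * k + + 1)) ℕ.+ size (oddSum (+ 4 * k + + 1))
  size-evenLast-4*+1 k = size-disjoint-images (oddSum m) (oddSum m) (evenLast m) id swap id swap-injective
    (λ v (eq , x+z-odd) → eq , proj₂ (proj₂ (oddSum⇒oddEvenEven k v eq x+z-odd)))
    (λ v (eq , x+z-odd) → swap-F v eq , proj₂ (proj₂ (oddSum⇒oddEvenEven k v eq x+z-odd)))
    cover
    (λ { _ v (eq , x+z-odd) (eq′ , x′+z′-odd) refl → even-odd-absurd
           (proj₁ (proj₂ (oddSum⇒oddEvenEven k (swap v) eq x+z-odd))) (proj₁ (oddSum⇒oddEvenEven k v eq′ x′+z′-odd)) })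
    where
    m = + 4 * k + + 1
    cover : ∀ w → F m w × EvenLast w → Image id (λ v → F m v × OddSum v) w ⊎ Image swap (λ v → F m v × OddSum v) w
    cover w (eq , z-even) with residue₁ k w eq
    ... | inj₁ (x-odd , _ , _)         = inj₁ (w , (eq , odd+even x-odd z-even) , refl)
    ... | inj₂ (inj₁ (_ , y-odd , _))  = inj₂ (swap w , (swap-F w eq , odd+even y-odd z-even) , refl)
    ... | inj₂ (inj₂ (_ , _ , z-odd))  = ⊥-elim (even-odd-absurd z-even z-odd)

  -- Representations by three odd numbers, modulo 8.

  -- Odd squares are 1 modulo 8, and 1 + 1 + 3 = 5.
  allOdd-residue : ∀ {m} v → F m v → AllOdd v → ∃ λ b → m ≡ + 8 * b + + 5
  allOdd-residue {m} (x , y , z) eq (x-odd , y-odd , z-odd) with odd-square x-odd | odd-square y-odd | odd-square z-odd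
  ... | a , x²≡ | b , y²≡ | c , z²≡ = a + b + + 3 * c , trans (sym eq) (rearrange x y z a b c x²≡ y²≡ z²≡)
    where
    rearrange : ∀ x y z a b c → x * x ≡ + 8 * a + + 1 → y * y ≡ + 8 * b + + 1 → z * z ≡ + 8 * c + + 1 →
      + 1 * x * x + + 1 * y * y + + 3 * z * z ≡ + 8 * (a + b + + 3 * c) + + 5
    rearrange x y z a b c x²≡ y²≡ z²≡ =
      linear-combination (+ 1) (cong₂ _+_ x²≡ y²≡) (+ 3) z²≡ (solve (x ∷ y ∷ z ∷ a ∷ b ∷ c ∷ []))

  size-allOdd-8*+1 : ∀ k → size (allOdd (+ 8 * k + + 1)) ≡ 0
  size-allOdd-8*+1 k = size-empty (allOdd (+ 8 * k + + 1)) λ v (eq , odds) →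
    let b , 8k+1≡8b+5 = allOdd-residue v eq odds in absurd b 8k+1≡8b+5
    where
    absurd : ∀ b → + 8 * k + + 1 ≡ + 8 * b + + 5 → ⊥
    absurd b eq = multiple-absurd 8 4 (k - b) (linear-multiple (+ 1) eq (solve (k ∷ b ∷ [])))

  -- 4p² + y² + 12q² equals both y² + (2p)² + 3(2q)² and (p + 3q)² + y² + 3(p - q)². For m ≡ 5
  -- modulo 8 it thus parametrizes the `OddSum` class once and the `AllOdd` class twice, which links
  -- the two.
  narrowForms : ∀ m → Enumeration (Quadratic 4 1 12 m)
  narrowForms = quadratics 4 1 12

  -- Since m is odd, so is y; then y² ≡ 1 modulo 8 leaves 4(p² + 3q²) ≡ 4, so p² + 3q² is odd.
  narrow-odd : ∀ k p y q → Quadratic 4 1 12 (+ 8 * k + + 5) (p , y , q) → Odd y × Odd (p + q)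
  narrow-odd k p y q eq = y-odd , p+q-odd (parity (p + q)) (odd-square y-odd)
    where
    y-odd-cases : ∀ {y} → Even y ⊎ Odd y → Quadratic 4 1 12 (+ 8 * k + + 5) (p , y , q) → Odd y
    y-odd-cases (inj₂ odd) _ = odd
    y-odd-cases (inj₁ (b , refl)) eq = ⊥-elim (multiple-absurd 4 5 (p * p + b * b + + 3 * q * q - + 2 * k)
      (linear-multiple (+ 1) eq (solve (p ∷ b ∷ q ∷ k ∷ []))))
    y-odd : Odd y
    y-odd = y-odd-cases (parity y) eq
    p+q-odd : Even (p + q) ⊎ Odd (p + q) → (∃ λ b → y * y ≡ + 8 * b + + 1) → Odd (p + q)
    p+q-odd (inj₂ odd) _ = odd
    -- Substituting p = 2l - q turns 4(p² + 3q²) into 16(l² - lq + q²), a multiple of 8.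
    p+q-odd (inj₁ (l , p+q≡2l)) (b , y²≡) = ⊥-elim (multiple-absurd 8 4
      (b - k + + 2 * l * l - + 2 * l * q + + 2 * q * q)
      (linear-combination (+ 1) (cong₂ _-_ eq y²≡) (- + 4 * (p + + 2 * l - q)) p+q≡2l
        (solve (p ∷ y ∷ q ∷ k ∷ b ∷ l ∷ []))))

  size-allOdd-8*+5 : ∀ k →
    size (allOdd (+ 8 * k + + 5)) ≡ size (narrowForms (+ 8 * k + + 5)) ℕ.+ size (narrowForms (+ 8 * k + + 5))
  size-allOdd-8*+5 k = size-disjoint-images (narrowForms m) (narrowForms m) (allOdd m)
    (rotate id) (rotate′ id) (rotate-injective id) (rotate′-injective id)
    (λ (p , y , q) eq → let y-odd , p+q-odd = narrow-odd k p y q eq in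
      turn m p y q eq , odd-p+3q p q p+q-odd , y-odd , odd-p-q p q p+q-odd)
    (λ (p , y , q) eq → let y-odd , p+q-odd = narrow-odd k p y q eq in
      turn′ m p y q eq , odd-p+3q p q p+q-odd , y-odd , odd-q-p p q p+q-odd)
    cover
    (λ v@(p , y , q) v′ eq _ → rotations-disjoint v v′ (odd-p+3q p q (proj₂ (narrow-odd k p y q eq))))
    where
    m = + 8 * k + + 5
    turn : ∀ m p y q → Quadratic 4 1 12 m (p , y , q) → F m (p + + 3 * q , y , p - q)
    turn m p y q eq = linear-multiple (+ 1) eq (solve (p ∷ y ∷ q ∷ m ∷ []))
    turn′ : ∀ m p y q → Quadratic 4 1 12 m (p , y , q) → F m (p + + 3 * q , y , q - p)
    turn′ m p y q eq = linear-multiple (+ 1) eq (solve (p ∷ y ∷ q ∷ m ∷ []))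
    unturn : ∀ m p y q → F m (p + + 3 * q , y , p - q) → Quadratic 4 1 12 m (p , y , q)
    unturn m p y q eq = linear-multiple (+ 1) eq (solve (p ∷ y ∷ q ∷ m ∷ []))
    unturn′ : ∀ m p y q → F m (p + + 3 * q , y , q - p) → Quadratic 4 1 12 m (p , y , q)
    unturn′ m p y q eq = linear-multiple (+ 1) eq (solve (p ∷ y ∷ q ∷ m ∷ []))
    cover : ∀ w → F m w × AllOdd w →
            Image (rotate id) (Quadratic 4 1 12 m) w ⊎ Image (rotate′ id) (Quadratic 4 1 12 m) w
    cover (_ , y , _) (eq , x-odd , _ , z-odd) with rotations-cover x-odd z-odd
    ... | p , q , refl , inj₁ refl = inj₁ ((p , y , q) , unturn m p y q eq , refl)
    ... | p , q , refl , inj₂ refl = inj₂ ((p , y , q) , unturn′ m p y q eq , refl)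

  -- An odd x + z forces x odd and both y and z even, so the triple has the shape (y, 2p, 2q).
  size-oddSum-8*+5 : ∀ k → size (oddSum (+ 8 * k + + 5)) ≡ size (narrowForms (+ 8 * k + + 5))
  size-oddSum-8*+5 k = size-image (narrowForms m) (oddSum m) stretch
    (λ eq → triple-≡ (ℤ.*-cancelˡ-≡ (+ 2) _ _ (cong (proj₁ ∘ proj₂) eq)) (cong proj₁ eq)
                     (ℤ.*-cancelˡ-≡ (+ 2) _ _ (cong (proj₂ ∘ proj₂) eq)))
    (λ (p , y , q) eq → to m p y q eq , odd+even (proj₁ (narrow-odd k p y q eq)) (q , refl))
    onto
    where
    m = + 8 * k + + 5
    stretch : Triple → Triple
    stretch (p , y , q) = y , + 2 * p , + 2 * q
    to : ∀ m p y q → Quadratic 4 1 12 m (p , y , q) → F m (y , + 2 * p , + 2 * q)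
    to m p y q eq = linear-multiple (+ 1) eq (solve (p ∷ y ∷ q ∷ m ∷ []))
    from : ∀ m p y q → F m (y , + 2 * p , + 2 * q) → Quadratic 4 1 12 m (p , y , q)
    from m p y q eq = linear-multiple (+ 1) eq (solve (p ∷ y ∷ q ∷ m ∷ []))
    4*-form : ∀ k → + 8 * k + + 5 ≡ + 4 * (+ 2 * k + + 1) + + 1
    4*-form = solve-∀
    onto : ∀ w → F m w × OddSum w → Image stretch (Quadratic 4 1 12 m) w
    onto w@(y , _ , _) (eq , x+z-odd) with oddSum⇒oddEvenEven (+ 2 * k + + 1) w (trans eq (4*-form k)) x+z-odd
    ... | _ , (p , refl) , (q , refl) = (p , y , q) , from m p y q eq , refl

  -- Passing from the coefficients 1, 1, 6 and from triangular numbers to the form.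

  sum-difference-injective : ∀ {x y x′ y′} → x + y ≡ x′ + y′ → x - y ≡ x′ - y′ → x ≡ x′ × y ≡ y′
  sum-difference-injective {x} {y} {x′} {y′} e₁ e₂ =
    x≡x′ , linear-combination (+ 1) e₁ (- + 1) x≡x′ (solve (x ∷ y ∷ x′ ∷ y′ ∷ []))
    where
    x≡x′ : x ≡ x′
    x≡x′ = ℤ.*-cancelˡ-≡ (+ 2) x x′ (linear-combination (+ 1) e₁ (+ 1) e₂ (solve (x ∷ y ∷ x′ ∷ y′ ∷ [])))

  -- (u + v)² + (u - v)² = 2(u² + v²). Conversely x² + y² = 2m - 6z² is even, so x + y is even and
  -- u, v are integers.
  size-116-2* : ∀ m → size (quadratics 1 1 6 (+ 2 * m)) ≡ size (forms m)
  size-116-2* m = size-image (forms m) (quadratics 1 1 6 _) sumDifference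
    (λ eq → let x≡ , y≡ = sum-difference-injective (cong proj₁ eq) (cong (proj₁ ∘ proj₂) eq)
            in triple-≡ x≡ y≡ (cong (proj₂ ∘ proj₂) eq))
    (λ (u , v , z) → to u v z) onto
    where
    sumDifference : Triple → Triple
    sumDifference (u , v , z) = u + v , u - v , z
    to : ∀ u v z → F m (u , v , z) → Quadratic 1 1 6 (+ 2 * m) (u + v , u - v , z)
    to u v z eq = linear-multiple (+ 2) eq (solve (u ∷ v ∷ z ∷ m ∷ []))
    from : ∀ u v z → Quadratic 1 1 6 (+ 2 * m) (u + v , u - v , z) → F m (u , v , z)
    from u v z eq = ℤ.*-cancelˡ-≡ (+ 2) _ _ (linear-multiple (+ 1) eq (solve (u ∷ v ∷ z ∷ m ∷ [])))
    onto : ∀ w → Quadratic 1 1 6 (+ 2 * m) w → Image sumDifference (F m) w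
    onto (x , y , z) eq = cases (parity (x + y))
      where
      cases : Even (x + y) ⊎ Odd (x + y) → Image sumDifference (F m) (x , y , z)
      cases (inj₁ (u , x+y≡2u)) =
        (u , u - y , z) , from u (u - y) z (subst (Quadratic 1 1 6 (+ 2 * m)) (sym image≡) eq) , image≡
        where
        image≡ : (u + (u - y) , u - (u - y) , z) ≡ (x , y , z)
        image≡ = triple-≡ (linear-multiple (- + 1) x+y≡2u (solve (x ∷ y ∷ u ∷ []))) (solve (y ∷ u ∷ [])) refl
      cases (inj₂ (k , x+y≡2k+1)) = ⊥-elim (multiple-absurd 2 1
        (m - + 3 * z * z - y * y - + 2 * k * k - + 2 * k + y * (+ 2 * k + + 1))
        (linear-combination (- + 1) eq (x - y + + 2 * k + + 1) x+y≡2k+1 (solve (x ∷ y ∷ z ∷ m ∷ k ∷ []))))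

  2*+1-injective : ∀ {x y} → + 2 * x + + 1 ≡ + 2 * y + + 1 → x ≡ y
  2*+1-injective {x} {y} eq = ℤ.*-cancelˡ-≡ (+ 2) x y (linear-multiple (+ 1) eq (solve (x ∷ y ∷ [])))

  +1-injective : ∀ {x y} → x + + 1 ≡ y + + 1 → x ≡ y
  +1-injective {x} {y} eq = linear-multiple (+ 1) eq (solve (x ∷ y ∷ []))

  -- Completing squares gives (2x + 1)² + (2y + 1)² + 6(2z + 1)² = 8(n + 1). Half the sum and half
  -- the difference of the first two odd numbers are x + y + 1 and x - y, and the equation is halved
  -- to one for 4(n + 1).
  t-116-oddLast : ∀ n → size (oddLast (+ 4 * (+ n + + 1))) ≡ t 1 1 6 n
  t-116-oddLast n = size-image (triangulars 1 1 6 n) (oddLast _) f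
    (λ eq → let x≡ , y≡ = sum-difference-injective (+1-injective (cong proj₁ eq)) (cong (proj₁ ∘ proj₂) eq)
            in triple-≡ x≡ y≡ (2*+1-injective (cong (proj₂ ∘ proj₂) eq)))
    (λ (x , y , z) eq → to x y z (+ n) (trans eq (ℤ.pos-* 2 n)) , (z , refl)) onto
    where
    f : Triple → Triple
    f (x , y , z) = x + y + + 1 , x - y , + 2 * z + + 1
    to : ∀ x y z N → Triangular 1 1 6 (+ 2 * N) (x , y , z) →
         F (+ 4 * (N + + 1)) (x + y + + 1 , x - y , + 2 * z + + 1)
    to x y z N eq = linear-multiple (+ 2) eq (solve (x ∷ y ∷ z ∷ N ∷ []))
    from : ∀ x y z N → F (+ 4 * (N + + 1)) (x + y + + 1 , x - y , + 2 * z + + 1) →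
           Triangular 1 1 6 (+ 2 * N) (x , y , z)
    from x y z N eq = ℤ.*-cancelˡ-≡ (+ 2) _ _ (linear-multiple (+ 1) eq (solve (x ∷ y ∷ z ∷ N ∷ [])))
    preimage : ∀ v {w} → F (+ 4 * (+ n + + 1)) w → f v ≡ w → Image f (Triangular 1 1 6 (+ (2 ℕ.* n))) w
    preimage (x , y , z) eq refl = (x , y , z) , trans (from x y z (+ n) eq) (sym (ℤ.pos-* 2 n)) , refl
    -- The first two coordinates of an image have opposite parity. Inverting the half sum and half
    -- difference gives one explicit preimage for each choice of the odd one.
    odd-even-≡ : ∀ a b c → f (a + b , a - b , c) ≡ (+ 2 * a + + 1 , + 2 * b , + 2 * c + + 1)
    odd-even-≡ a b c = triple-≡ (solve (a ∷ b ∷ [])) (solve (a ∷ b ∷ [])) refl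
    even-odd-≡ : ∀ a b c → f (a + b , a - b - + 1 , c) ≡ (+ 2 * a , + 2 * b + + 1 , + 2 * c + + 1)
    even-odd-≡ a b c = triple-≡ (solve (a ∷ b ∷ [])) (solve (a ∷ b ∷ [])) refl
    onto : ∀ w → F (+ 4 * (+ n + + 1)) w × OddLast w → Image f (Triangular 1 1 6 (+ (2 ℕ.* n))) w
    onto w (eq , z-odd) with residue₀ (+ n + + 1) w eq
    ... | inj₁ ((a , refl) , (b , refl) , (c , refl))         = preimage (a + b , a - b , c) eq (odd-even-≡ a b c)
    ... | inj₂ (inj₁ ((a , refl) , (b , refl) , (c , refl)))  = preimage (a + b , a - b - + 1 , c) eq (even-odd-≡ a b c)
    ... | inj₂ (inj₂ (_ , _ , z-even))                        = ⊥-elim (even-odd-absurd z-even z-odd)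

  -- Multiplying by 8 and completing squares adds 1 + 1 + 3 = 5.
  t-113-allOdd : ∀ n → size (allOdd (+ 8 * + n + + 5)) ≡ t 1 1 3 n
  t-113-allOdd n = size-image (triangulars 1 1 3 n) (allOdd _) f
    (λ eq → triple-≡ (2*+1-injective (cong proj₁ eq)) (2*+1-injective (cong (proj₁ ∘ proj₂) eq))
                     (2*+1-injective (cong (proj₂ ∘ proj₂) eq)))
    (λ (x , y , z) eq → to x y z (+ n) (trans eq (ℤ.pos-* 2 n)) , (x , refl) , (y , refl) , (z , refl))
    (λ { _ (eq , (x , refl) , (y , refl) , (z , refl)) →
         (x , y , z) , trans (from x y z (+ n) eq) (sym (ℤ.pos-* 2 n)) , refl })
    where
    f : Triple → Triple
    f (x , y , z) = + 2 * x + + 1 , + 2 * y + + 1 , + 2 * z + + 1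
    to : ∀ x y z N → Triangular 1 1 3 (+ 2 * N) (x , y , z) →
         F (+ 8 * N + + 5) (+ 2 * x + + 1 , + 2 * y + + 1 , + 2 * z + + 1)
    to x y z N eq = linear-multiple (+ 4) eq (solve (x ∷ y ∷ z ∷ N ∷ []))
    from : ∀ x y z N → F (+ 8 * N + + 5) (+ 2 * x + + 1 , + 2 * y + + 1 , + 2 * z + + 1) →
           Triangular 1 1 3 (+ 2 * N) (x , y , z)
    from x y z N eq = ℤ.*-cancelˡ-≡ (+ 4) _ _ (linear-multiple (+ 1) eq (solve (x ∷ y ∷ z ∷ N ∷ [])))

  -- Relations between the counts.

  r s : ℤ → ℕ
  r m = size (forms m)
  s m = size (oddSum m)

  size-oddLast-4*≡4s : ∀ m → size (oddLast (+ 4 * m)) ≡ 4 ℕ.* s m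
  size-oddLast-4*≡4s m = trans (size-oddLast-4* m)
    (trans (cong₂ ℕ._+_ (size-oddEvenOdd-4* m) (size-oddEvenOdd-4* m)) (fourfold (s m)))
    where
    fourfold : ∀ k → (k ℕ.+ k) ℕ.+ (k ℕ.+ k) ≡ 4 ℕ.* k
    fourfold = ℕSolver.solve-∀

  r-4* : ∀ m → r (+ 4 * m) ≡ 4 ℕ.* s m ℕ.+ r m
  r-4* m = trans (size-forms-4* m) (cong (ℕ._+ r m) (size-oddLast-4*≡4s m))

  s-4* : ∀ m → s (+ 4 * m) ≡ 2 ℕ.* s m
  s-4* m = trans (size-oddSum-4* m) (trans (size-oddEvenOdd-4* m) (cong (s m ℕ.+_) (sym (ℕ.+-identityʳ _))))

  r-4*+1 : ∀ k → r (+ 4 * k + + 1) ≡ 2 ℕ.* s (+ 4 * k + + 1) ℕ.+ size (allOdd (+ 4 * k + + 1))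
  r-4*+1 k = trans (size-forms-4*+1 k) (cong (ℕ._+ size (allOdd (+ 4 * k + + 1)))
    (trans (size-evenLast-4*+1 k) (cong (s (+ 4 * k + + 1) ℕ.+_) (sym (ℕ.+-identityʳ _)))))

  r-8*+1 : ∀ k → r (+ 8 * k + + 1) ≡ 2 ℕ.* s (+ 8 * k + + 1)
  r-8*+1 k = trans
    (subst (λ m → r m ≡ 2 ℕ.* s m ℕ.+ size (allOdd m)) (4*-form k) (r-4*+1 (+ 2 * k)))
    (trans (cong (2 ℕ.* s (+ 8 * k + + 1) ℕ.+_) (size-allOdd-8*+1 k)) (ℕ.+-identityʳ _))
    where
    4*-form : ∀ k → + 4 * (+ 2 * k) + + 1 ≡ + 8 * k + + 1
    4*-form = solve-∀

  allOdd-8*+5 : ∀ k → size (allOdd (+ 8 * k + + 5)) ≡ 2 ℕ.* s (+ 8 * k + + 5)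
  allOdd-8*+5 k = trans (size-allOdd-8*+5 k) (trans (cong₂ ℕ._+_ s≡ s≡) (cong (s (+ 8 * k + + 5) ℕ.+_) (sym (ℕ.+-identityʳ _))))
    where
    s≡ = sym (size-oddSum-8*+5 k)

  r-8*+5 : ∀ k → r (+ 8 * k + + 5) ≡ 4 ℕ.* s (+ 8 * k + + 5)
  r-8*+5 k = trans
    (subst (λ m → r m ≡ 2 ℕ.* s m ℕ.+ size (allOdd m)) (4*-form k) (r-4*+1 (+ 2 * k + + 1)))
    (trans (cong (2 ℕ.* s (+ 8 * k + + 5) ℕ.+_) (allOdd-8*+5 k)) (fourfold (s (+ 8 * k + + 5))))
    where
    4*-form : ∀ k → + 4 * (+ 2 * k + + 1) + + 1 ≡ + 8 * k + + 5
    4*-form = solve-∀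
    fourfold : ∀ k → 2 ℕ.* k ℕ.+ 2 ℕ.* k ≡ 4 ℕ.* k
    fourfold = ℕSolver.solve-∀

  -- Expressing t and N through s.

  t-116 : ∀ n m → + n + + 1 ≡ m → t 1 1 6 n ≡ 4 ℕ.* s m
  t-116 n m refl = trans (sym (t-116-oddLast n)) (size-oddLast-4*≡4s m)

  t-116-4* : ∀ n m → + n + + 1 ≡ + 4 * m → t 1 1 6 n ≡ 8 ℕ.* s m
  t-116-4* n m eq = trans (t-116 n (+ 4 * m) eq) (trans (cong (4 ℕ.*_) (s-4* m)) (eightfold (s m)))
    where
    eightfold : ∀ k → 4 ℕ.* (2 ℕ.* k) ≡ 8 ℕ.* k
    eightfold = ℕSolver.solve-∀

  -- Definitional: `+ n + + 1` computes to `+ (n ℕ.+ 1)`, and `forms` filters the same box by the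
  -- same test as `N`.
  N-113 : ∀ n m → + n + + 1 ≡ m → N 1 1 3 (n ℕ.+ 1) ≡ r m
  N-113 n m refl = refl

  t-113 : ∀ n → t 1 1 3 n ≡ 2 ℕ.* s (+ 8 * + n + + 5)
  t-113 n = trans (sym (t-113-allOdd n)) (allOdd-8*+5 (+ n))

  N-116-2* : ∀ n → N 1 1 6 (2 ℕ.* n) ≡ N 1 1 3 n
  N-116-2* n = trans (cong (λ m → size (quadratics 1 1 6 m)) (ℤ.pos-* 2 n)) (size-116-2* (+ n))

  -- The ratios 8/5 and 4/3 are stated with cleared denominators; both counts are multiples of one
  -- value of s, here `w`.
  proportional : ∀ a b c d w {u v} → u ≡ c ℕ.* w → v ≡ d ℕ.* w → a ℕ.* c ≡ b ℕ.* d → a ℕ.* u ≡ b ℕ.* v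
  proportional a b c d w refl refl ac≡bd =
    trans (sym (ℕ.*-assoc a c w)) (trans (cong (ℕ._* w) ac≡bd) (ℕ.*-assoc b d w))

  linear-pos : ∀ a n b → + (a ℕ.* n ℕ.+ b) + + 1 ≡ + a * + n + + suc b
  linear-pos a n b = trans (cong (λ k → k + + b + + 1) (ℤ.pos-* a n)) (shift (+ a * + n) (+ b))
    where
    shift : ∀ x b → x + b + + 1 ≡ x + (+ 1 + b)
    shift = solve-∀

  remainder-form : ∀ n d .{{_ : NonZero d}} {ρ} → n ℕ.% d ≡ ρ → + n + + 1 ≡ + d * + (n ℕ./ d) + + suc ρ
  remainder-form n d {ρ} n%d≡ρ = trans (cong (_+ + 1) n≡) (shift (+ d) (+ (n ℕ./ d)) (+ ρ))
    where
    n≡ : + n ≡ + ρ + + (n ℕ./ d) * + d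
    n≡ = trans (cong +_ (trans (ℕ.m≡m%n+[m/n]*n n d) (cong (ℕ._+ n ℕ./ d ℕ.* d) n%d≡ρ)))
               (cong (λ k → + ρ + k) (ℤ.pos-* (n ℕ./ d) d))
    shift : ∀ d q ρ → ρ + q * d + + 1 ≡ d * q + (+ 1 + ρ)
    shift = solve-∀

  -- The ratio `c` of r to s depends on the residue of m: it is 1 for m ≡ 2, 3 modulo 4, 2 for m ≡ 1
  -- and 4 for m ≡ 5 modulo 8.
  r-of-4* : ∀ m c → r m ≡ c ℕ.* s m → r (+ 4 * m) ≡ (4 ℕ.+ c) ℕ.* s m
  r-of-4* m c r≡ = trans (r-4* m) (trans (cong (4 ℕ.* s m ℕ.+_) r≡) (sym (ℕ.*-distribʳ-+ (s m) 4 c)))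

  4*⟨8*+5⟩ : ∀ q → + 32 * q + + 20 ≡ + 4 * (+ 8 * q + + 5)
  4*⟨8*+5⟩ = solve-∀

  -- The identities, one residue class at a time.

  t-116-8*+4 : ∀ n → t 1 1 6 (8 ℕ.* n ℕ.+ 4) ≡ 2 ℕ.* t 1 1 3 n
  t-116-8*+4 n =
    trans (t-116 (8 ℕ.* n ℕ.+ 4) m (linear-pos 8 n 4))
          (trans (ℕ.*-assoc 2 2 (s m)) (cong (2 ℕ.*_) (sym (t-113 n))))
    where
    m = + 8 * + n + + 5

  -- The shifted index 32n + 20 is 4(8n + 5), and s(4m) = 2s(m) accounts for the extra factor 2
  -- compared with the index 8n + 4.
  t-116-32*+19 : ∀ n → t 1 1 6 (32 ℕ.* n ℕ.+ 19) ≡ 4 ℕ.* t 1 1 3 n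
  t-116-32*+19 n =
    trans (t-116-4* (32 ℕ.* n ℕ.+ 19) m (trans (linear-pos 32 n 19) (4*⟨8*+5⟩ (+ n))))
          (trans (ℕ.*-assoc 4 2 (s m)) (cong (4 ℕ.*_) (sym (t-113 n))))
    where
    m = + 8 * + n + + 5

  t-116-%4 : ∀ n → n ℕ.% 4 ≡ 1 ⊎ n ℕ.% 4 ≡ 2 → t 1 1 6 n ≡ 4 ℕ.* N 1 1 3 (n ℕ.+ 1)
  t-116-%4 n (inj₁ n%4≡1) =
    trans (t-116 n m m≡) (cong (4 ℕ.*_) (sym (trans (N-113 n m m≡) (size-forms-4*+2 q))))
    where
    q  = + (n ℕ./ 4)
    m  = + 4 * q + + 2
    m≡ = remainder-form n 4 n%4≡1
  t-116-%4 n (inj₂ n%4≡2) =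
    trans (t-116 n m m≡) (cong (4 ℕ.*_) (sym (trans (N-113 n m m≡) (size-forms-4*+3 q))))
    where
    q  = + (n ℕ./ 4)
    m  = + 4 * q + + 3
    m≡ = remainder-form n 4 n%4≡2

  t-116-%8≡0 : ∀ n → n ℕ.% 8 ≡ 0 → t 1 1 6 n ≡ 2 ℕ.* N 1 1 3 (n ℕ.+ 1)
  t-116-%8≡0 n n%8≡0 =
    trans (t-116 n m m≡)
          (trans (ℕ.*-assoc 2 2 (s m)) (cong (2 ℕ.*_) (sym (trans (N-113 n m m≡) (r-8*+1 q)))))
    where
    q  = + (n ℕ./ 8)
    m  = + 8 * q + + 1
    m≡ = remainder-form n 8 n%8≡0

  t-116-%8≡4-%32≡19 : ∀ n → n ℕ.% 8 ≡ 4 ⊎ n ℕ.% 32 ≡ 19 → t 1 1 6 n ≡ N 1 1 3 (n ℕ.+ 1)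
  t-116-%8≡4-%32≡19 n (inj₁ n%8≡4) = trans (t-116 n m m≡) (sym (trans (N-113 n m m≡) (r-8*+5 q)))
    where
    q  = + (n ℕ./ 8)
    m  = + 8 * q + + 5
    m≡ = remainder-form n 8 n%8≡4
  t-116-%8≡4-%32≡19 n (inj₂ n%32≡19) =
    trans (t-116-4* n m m≡) (sym (trans (N-113 n (+ 4 * m) m≡) (r-of-4* m 4 (r-8*+5 q))))
    where
    q  = + (n ℕ./ 32)
    m  = + 8 * q + + 5
    m≡ = trans (remainder-form n 32 n%32≡19) (4*⟨8*+5⟩ q)

  t-116-%16 : ∀ n → n ℕ.% 16 ≡ 7 ⊎ n ℕ.% 16 ≡ 11 → 5 ℕ.* t 1 1 6 n ≡ 8 ℕ.* N 1 1 3 (n ℕ.+ 1)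
  t-116-%16 n (inj₁ n%16≡7) =
    -- With n + 1 = 4m, t is 8s(m) and N is (4 + 1)s(m).
    proportional 5 8 8 5 (s m) (t-116-4* n m m≡) (trans (N-113 n (+ 4 * m) m≡) (r-of-4* m 1 r≡)) refl
    where
    4*⟨4*+2⟩ : ∀ q → + 16 * q + + 8 ≡ + 4 * (+ 4 * q + + 2)
    4*⟨4*+2⟩ = solve-∀
    q  = + (n ℕ./ 16)
    m  = + 4 * q + + 2
    m≡ = trans (remainder-form n 16 n%16≡7) (4*⟨4*+2⟩ q)
    r≡ = trans (size-forms-4*+2 q) (sym (ℕ.*-identityˡ (s m)))
  t-116-%16 n (inj₂ n%16≡11) =
    proportional 5 8 8 5 (s m) (t-116-4* n m m≡) (trans (N-113 n (+ 4 * m) m≡) (r-of-4* m 1 r≡)) refl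
    where
    4*⟨4*+3⟩ : ∀ q → + 16 * q + + 12 ≡ + 4 * (+ 4 * q + + 3)
    4*⟨4*+3⟩ = solve-∀
    q  = + (n ℕ./ 16)
    m  = + 4 * q + + 3
    m≡ = trans (remainder-form n 16 n%16≡11) (4*⟨4*+3⟩ q)
    r≡ = trans (size-forms-4*+3 q) (sym (ℕ.*-identityˡ (s m)))

  t-116-%32≡3 : ∀ n → n ℕ.% 32 ≡ 3 → 3 ℕ.* t 1 1 6 n ≡ 4 ℕ.* N 1 1 3 (n ℕ.+ 1)
  t-116-%32≡3 n n%32≡3 =
    -- Now m ≡ 1 modulo 8, so t is 8s(m) and N is (4 + 2)s(m).
    proportional 3 4 8 6 (s m) (t-116-4* n m m≡) (trans (N-113 n (+ 4 * m) m≡) (r-of-4* m 2 (r-8*+1 q))) refl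
    where
    4*⟨8*+1⟩ : ∀ q → + 32 * q + + 4 ≡ + 4 * (+ 8 * q + + 1)
    4*⟨8*+1⟩ = solve-∀
    q  = + (n ℕ./ 32)
    m  = + 8 * q + + 1
    m≡ = trans (remainder-form n 32 n%32≡3) (4*⟨8*+1⟩ q)

open TernaryForms
open import Data.Nat using (_+_; _*_; _%_)

theorem3p1 : ∀ (n : ℕ) → 0 Data.Nat.< n →
    (N 1 1 6 (2 * n) ≡ N 1 1 3 n)
    × (t 1 1 6 (8 * n + 4) ≡ 2 * t 1 1 3 n)
    × (t 1 1 6 (32 * n + 19) ≡ 4 * t 1 1 3 n)
    × (n % 16 ≢ 15 →
    ((n % 4 ≡ 1 ⊎ n % 4 ≡ 2) → t 1 1 6 n ≡ 4 * N 1 1 3 (n + 1))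
    × (n % 8 ≡ 0 → t 1 1 6 n ≡ 2 * N 1 1 3 (n + 1))
    × ((n % 8 ≡ 4 ⊎ n % 32 ≡ 19) → t 1 1 6 n ≡ N 1 1 3 (n + 1))
    × ((n % 16 ≡ 7 ⊎ n % 16 ≡ 11) → 5 * t 1 1 6 n ≡ 8 * N 1 1 3 (n + 1))
    × (n % 32 ≡ 3 → 3 * t 1 1 6 n ≡ 4 * N 1 1 3 (n + 1)))
theorem3p1 n _ =
    N-116-2* n
  , t-116-8*+4 n
  , t-116-32*+19 n
  , λ _ → t-116-%4 n , t-116-%8≡0 n , t-116-%8≡4-%32≡19 n , t-116-%16 n , t-116-%32≡3 n
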